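{- For every $K_3N$ $n=pqr$, $A<\sqrt{3(p-1)}-\dfrac12\sqrt[4]{\dfrac{p-1}{12}}$.
   Context: A $K_3N$ (Korselt number with three factors) is an integer $n$ together with a factorisation $n=pqr$, where $1<p<q<r$ are odd integers (not necessarily prime) such that each of $p-1,\ q-1,\ r-1$ divides $n-1$, and such that $E:=\dfrac{pq-1}{r-1}$ (which is an integer by the divisibility condition) satisfies $E\ge 2$. Put $H:=\gcd(p-1,q-1,r-1)$ and $A:=\frac{p-1}{H}$. -}

module Defs where

open import Data.Nat.Base as ℕ using (ℕ; zero; suc; NonZero)
import Data.Nat.Properties as ℕ
open import Data.Nat.Coprimality as Coprimality using (1-coprimeTo)
open import Data.Nat.Divisibility using (_∣_; _∤_; n∣m*n; ∣m+n∣m⇒∣n)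
open import Data.Nat.DivMod using (m/n*n≡m)
open import Data.Nat.GCD using (gcd; gcd[m,n]∣m; gcd[m,n]≢0)
open import Data.Integer.Base as ℤ using (+_; -[1+_])
import Data.Integer.Properties as ℤ
import Data.Rational.Unnormalised.Base as ℚᵘ
import Data.Rational.Unnormalised.Properties as ℚᵘ
open import Data.Rational.Base hiding (NonZero)
open import Data.Rational.Properties
open import Data.Rational.Solver using (module +-*-Solver)
open import Algebra.Definitions.RawSemiring +-*-rawSemiring using (_^_)
open import Data.Product.Base using (∃; ∃-syntax; _×_; _,_)
open import Data.Sum.Base using (_⊎_; inj₁; inj₂; map₂)
open import Data.Empty using (⊥; ⊥-elim)
open import Relation.Nullary.Decidable using (yes; no)
open import Relation.Binary.Definitions using (tri<; tri≈; tri>)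
open import Relation.Binary.PropositionalEquality
  using (_≡_; refl; sym; trans; cong; subst; subst₂)

open +-*-Solver using (solve; _:+_; _:*_; _:-_; _:=_; con)

------------------------------------------------------------------------
-- Real numbers, as two-sided (Dedekind) cuts of the rationals:
-- `Lower q` reads "q < x" and `Upper q` reads "x < q".

record ℝ : Set₁ where
  field
    Lower Upper     : ℚ → Set
    lower-inhabited : ∃[ q ] Lower q
    upper-inhabited : ∃[ q ] Upper q
    lower-closed    : ∀ {q r} → q < r → Lower r → Lower q
    upper-closed    : ∀ {q r} → q < r → Upper q → Upper r
    lower-open      : ∀ {q} → Lower q → ∃[ r ] q < r × Lower r
    upper-open      : ∀ {q} → Upper q → ∃[ r ] r < q × Upper r
    disjoint        : ∀ {q} → Lower q → Upper q → ⊥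
    located         : ∀ {q r} → q < r → Lower q ⊎ Upper r

open ℝ

infix 4 _<ℝ_

_<ℝ_ : ℝ → ℝ → Set
x <ℝ y = ∃[ q ] Upper x q × Lower y q

module CutLemmas where

  0<1 : 0ℚ < 1ℚ
  0<1 = positive⁻¹ 1ℚ

  q<q+1 : ∀ q → q < q + 1ℚ
  q<q+1 q = subst (_< q + 1ℚ) (+-identityʳ q) (+-monoʳ-< q 0<1)

  q-1<q : ∀ q → q - 1ℚ < q
  q-1<q q = subst (q - 1ℚ <_) (+-identityʳ q) (+-monoʳ-< q (negative⁻¹ (- 1ℚ)))

  -- Multiplication and division with hypotheses `0ℚ < q` rather than instances

  *-monoˡ : ∀ {q s t} → 0ℚ < q → s < t → q * s < q * t
  *-monoˡ {q} 0<q = *-monoʳ-<-pos q {{positive 0<q}}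

  *-monoʳ : ∀ {q s t} → 0ℚ < q → s < t → s * q < t * q
  *-monoʳ {q} 0<q = *-monoˡ-<-pos q {{positive 0<q}}

  *-mono≤ˡ : ∀ {q s t} → 0ℚ ≤ q → s ≤ t → q * s ≤ q * t
  *-mono≤ˡ {q} 0≤q = *-monoˡ-≤-nonNeg q {{nonNegative 0≤q}}

  *-mono≤ʳ : ∀ {q s t} → 0ℚ ≤ q → s ≤ t → s * q ≤ t * q
  *-mono≤ʳ {q} 0≤q = *-monoʳ-≤-nonNeg q {{nonNegative 0≤q}}

  *-cancelˡ : ∀ {q s t} → 0ℚ < q → q * s < q * t → s < t
  *-cancelˡ {q} 0<q =
    *-cancelˡ-<-nonNeg q {{pos⇒nonNeg q {{positive 0<q}}}}

  recip : ∀ {q} → 0ℚ < q → ∃[ i ] 0ℚ < i × q * i ≡ 1ℚ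
  recip {q} 0<q =
    let instance q>0 = positive 0<q
                 q≢0 = pos⇒nonZero q
    in 1/ q , positive⁻¹ (1/ q) {{1/pos⇒pos q}} , *-inverseʳ q

  q*[s*i]≡s : ∀ q s i → q * i ≡ 1ℚ → q * (s * i) ≡ s
  q*[s*i]≡s q s i qi≡1 = trans
    (solve 3 (λ q s i → q :* (s :* i) := s :* (q :* i)) refl q s i)
    (trans (cong (s *_) qi≡1) (*-identityʳ s))

  between-below : ∀ {q s t} → 0ℚ < q → s < q * t → ∃[ c ] c < t × s < q * c
  between-below {q} {s} {t} 0<q s<qt =
    let i , 0<i , qi≡1 = recip 0<q
        eq = q*[s*i]≡s q s i qi≡1
        c , si<c , c<t = <-dense (*-cancelˡ 0<q (subst (_< q * t) (sym eq) s<qt))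
    in c , c<t , subst (_< q * c) eq (*-monoˡ 0<q si<c)

  between-above : ∀ {q s t} → 0ℚ ≤ q → q * t < s → ∃[ c ] t < c × q * c < s
  between-above {q} {s} {t} 0≤q qt<s with <-cmp 0ℚ q
  ... | tri< 0<q _ _ =
    let i , 0<i , qi≡1 = recip 0<q
        eq = q*[s*i]≡s q s i qi≡1
        c , t<c , c<si = <-dense (*-cancelˡ 0<q (subst (q * t <_) (sym eq) qt<s))
    in c , t<c , subst (q * c <_) eq (*-monoˡ 0<q c<si)
  ... | tri≈ _ refl _ = t + 1ℚ , q<q+1 t ,
    subst (_< s) (trans (*-zeroˡ t) (sym (*-zeroˡ (t + 1ℚ)))) qt<s
  ... | tri> _ _ q<0 = ⊥-elim (<-irrefl refl (<-≤-trans q<0 0≤q))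

  max< : ∀ {p q r} → p < r → q < r → p ⊔ q < r
  max< {p} {q} {r} p<r q<r with ⊔-sel p q
  ... | inj₁ eq = subst (_< r) (sym eq) p<r
  ... | inj₂ eq = subst (_< r) (sym eq) q<r

  min> : ∀ {p q r} → r < p → r < q → r < p ⊓ q
  min> {p} {q} {r} r<p r<q with ⊓-sel p q
  ... | inj₁ eq = subst (r <_) (sym eq) r<p
  ... | inj₂ eq = subst (r <_) (sym eq) r<q

  <-or-≥ : ∀ q p → q < p ⊎ p ≤ q
  <-or-≥ q p with q <? p
  ... | yes q<p = inj₁ q<p
  ... | no  q≮p = inj₂ (≮⇒≥ q≮p)

  -- Monotonicity and continuity of powers

  ^-nonNeg : ∀ {q} n → 0ℚ ≤ q → 0ℚ ≤ q ^ n
  ^-nonNeg zero    0≤q = <⇒≤ 0<1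
  ^-nonNeg {q} (suc n) 0≤q =
    subst (_≤ q * q ^ n) (*-zeroʳ q) (*-mono≤ˡ 0≤q (^-nonNeg n 0≤q))

  ^-pos : ∀ {q} n → 0ℚ < q → 0ℚ < q ^ n
  ^-pos zero    0<q = 0<1
  ^-pos {q} (suc n) 0<q =
    subst (_< q * q ^ n) (*-zeroʳ q) (*-monoˡ 0<q (^-pos n 0<q))

  ^-mono-≤ : ∀ {q r} n → 0ℚ ≤ q → q ≤ r → q ^ n ≤ r ^ n
  ^-mono-≤ zero    0≤q q≤r = ≤-refl
  ^-mono-≤ (suc n) 0≤q q≤r = ≤-trans
    (*-mono≤ˡ 0≤q (^-mono-≤ n 0≤q q≤r))
    (*-mono≤ʳ (^-nonNeg n (≤-trans 0≤q q≤r)) q≤r)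

  ^-mono-< : ∀ {q r} n .{{_ : NonZero n}} → 0ℚ ≤ q → q < r → q ^ n < r ^ n
  ^-mono-< (suc n) 0≤q q<r = ≤-<-trans
    (*-mono≤ˡ 0≤q (^-mono-≤ n 0≤q (<⇒≤ q<r)))
    (*-monoʳ (^-pos n (≤-<-trans 0≤q q<r)) q<r)

  ^-cont-above : ∀ {q s} n → 0ℚ ≤ q → q ^ n < s → ∃[ r ] q < r × r ^ n < s
  ^-cont-above {q} zero 0≤q 1<s = q + 1ℚ , q<q+1 q , 1<s
  ^-cont-above {q} {s} (suc n) 0≤q qqⁿ<s =
    let c , qⁿ<c , qc<s = between-above 0≤q qqⁿ<s
        0≤c = <⇒≤ (≤-<-trans (^-nonNeg n 0≤q) qⁿ<c)
        r₀ , q<r₀ , cr₀<s = between-above 0≤c (subst (_< s) (*-comm q c) qc<s)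
        r₁ , q<r₁ , r₁ⁿ<c = ^-cont-above n 0≤q qⁿ<c
        r = r₀ ⊓ r₁
        q<r = min> q<r₀ q<r₁
        0≤r = <⇒≤ (≤-<-trans 0≤q q<r)
        rⁿ≤c = ≤-trans (^-mono-≤ n 0≤r (p⊓q≤q r₀ r₁)) (<⇒≤ r₁ⁿ<c)
    in r , q<r ,
       ≤-<-trans (≤-trans (*-mono≤ˡ 0≤r rⁿ≤c) (*-mono≤ʳ 0≤c (p⊓q≤p r₀ r₁)))
                 (subst (_< s) (*-comm c r₀) cr₀<s)

  ^-cont-below : ∀ {q s} n → 0ℚ < q → s < q ^ n →
                 ∃[ r ] 0ℚ < r × r < q × s < r ^ n
  ^-cont-below {q} zero 0<q s<1 =
    let r , 0<r , r<q = <-dense 0<q in r , 0<r , r<q , s<1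
  ^-cont-below {q} {s} (suc n) 0<q s<qqⁿ =
    let s′ = s ⊔ 0ℚ
        c , c<qⁿ , s′<qc =
          between-below {q} {s′} 0<q (max< s<qqⁿ (^-pos (suc n) 0<q))
        0<c = *-cancelˡ 0<q (subst (_< q * c) (sym (*-zeroʳ q))
                (≤-<-trans (p≤q⊔p s 0ℚ) s′<qc))
        r₀ , r₀<q , s′<cr₀ =
          between-below {c} {s′} 0<c (subst (s′ <_) (*-comm q c) s′<qc)
        r₁ , 0<r₁ , r₁<q , c<r₁ⁿ = ^-cont-below n 0<q c<qⁿ
        r = r₀ ⊔ r₁
        0<r = <-≤-trans 0<r₁ (p≤q⊔p r₀ r₁)
        c≤rⁿ = ≤-trans (<⇒≤ c<r₁ⁿ) (^-mono-≤ n (<⇒≤ 0<r₁) (p≤q⊔p r₀ r₁))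
    in r , 0<r , max< r₀<q r₁<q ,
       ≤-<-trans (p≤p⊔q s 0ℚ)
         (<-≤-trans (subst (s′ <_) (*-comm c r₀) s′<cr₀)
           (≤-trans (*-mono≤ʳ (<⇒≤ 0<c) (p≤p⊔q r₀ r₁))
                    (*-mono≤ˡ (<⇒≤ 0<r) c≤rⁿ)))

  ^-dominates : ∀ {q} n .{{_ : NonZero n}} → 1ℚ ≤ q → q ≤ q ^ n
  ^-dominates {q} (suc n) 1≤q = subst (_≤ q * q ^ n) (*-identityʳ q)
    (*-mono≤ˡ (≤-trans (<⇒≤ 0<1) 1≤q) (1≤qⁿ n))
    where
    1≤qⁿ : ∀ m → 1ℚ ≤ q ^ m
    1≤qⁿ zero    = ≤-refl
    1≤qⁿ (suc m) = ≤-trans 1≤q (subst (_≤ q * q ^ m) (*-identityʳ q)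
      (*-mono≤ˡ (≤-trans (<⇒≤ 0<1) 1≤q) (1≤qⁿ m)))

  -- Archimedean property

  ι : ℕ → ℚ
  ι k = mkℚ (+ k) 0 (Coprimality.sym (1-coprimeTo k))

  ι-suc : ∀ k → ι (suc k) ≡ 1ℚ + ι k
  ι-suc k = toℚᵘ-injective (ℚᵘ.≃-trans
    (ℚᵘ.*≡* (cong (ℤ._* + 1) (trans (cong +_ (cong suc (sym (ℕ.*-identityʳ k))))
                                    (cong (λ z → + 1 ℤ.+ z) (ℤ.pos-* k 1)))))
    (ℚᵘ.≃-sym (toℚᵘ-homo-+ 1ℚ (ι k))))

  ≤-ι : ∀ q → ∃[ k ] q ≤ ι k
  ≤-ι (mkℚ (+ n) d c) = n , *≤* (subst₂ ℤ._≤_ (ℤ.pos-* n 1) (ℤ.pos-* n (suc d))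
    (ℤ.+≤+ (ℕ.*-monoʳ-≤ n (ℕ.s≤s ℕ.z≤n))))
  ≤-ι (mkℚ -[1+ n ] d c) = 0 , *≤* ℤ.-≤+

  archimedean : ∀ {δ} q → 0ℚ < δ → ∃[ k ] q ≤ ι k * δ
  archimedean {δ} q 0<δ =
    let i , 0<i , δi≡1 = recip 0<δ
        k , qi≤k = ≤-ι (q * i)
    in k , subst₂ _≤_ (q*[s*i]≡s δ q i δi≡1) (*-comm δ (ι k))
             (*-mono≤ˡ (<⇒≤ 0<δ) qi≤k)

  lower<upper : ∀ x {q r} → Lower x q → Upper x r → q < r
  lower<upper x {q} {r} Lq Ur with <-cmp q r
  ... | tri< q<r _ _  = q<r
  ... | tri≈ _ refl _ = ⊥-elim (disjoint x Lq Ur)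
  ... | tri> _ _ r<q  = ⊥-elim (disjoint x (lower-closed x r<q Lq) Ur)

  upper-closed-≤ : ∀ x {q r} → q ≤ r → Upper x q → Upper x r
  upper-closed-≤ x {q} {r} q≤r Uq =
    let s , s<q , Us = upper-open x Uq in upper-closed x (<-≤-trans s<q q≤r) Us

  halves : ∀ ε → ½ * ε + ½ * ε ≡ ε
  halves = solve 1 (λ ε → con ½ :* ε :+ con ½ :* ε := ε) refl

  0<half : ∀ {ε} → 0ℚ < ε → 0ℚ < ½ * ε
  0<half {ε} 0<ε = subst (_< ½ * ε) (*-zeroʳ ½) (*-monoˡ (positive⁻¹ ½) 0<ε)

  0<diff : ∀ {q r} → q < r → 0ℚ < r - q
  0<diff {q} {r} q<r = subst (_< r - q) (+-inverseʳ q) (+-monoˡ-< (- q) q<r)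

  add-sub : ∀ a b → a + (b - a) ≡ b
  add-sub = solve 2 (λ a b → a :+ (b :- a) := b) refl

  step : ∀ a δ j → a + (1ℚ + j) * δ ≡ (a + δ) + j * δ
  step = solve 3 (λ a δ j → a :+ (con 1ℚ :+ j) :* δ := (a :+ δ) :+ j :* δ) refl

  shift : ∀ a b ε → (a - (b + ε)) + (ε + ε) ≡ (a + ε) - b
  shift = solve 3 (λ a b ε → (a :- (b :+ ε)) :+ (ε :+ ε) := (a :+ ε) :- b) refl

  +0*δ : ∀ a δ → a + 0ℚ * δ ≡ a
  +0*δ a δ = trans (cong (λ z → a + z) (*-zeroˡ δ)) (+-identityʳ a)

  +[1+k]*δ : ∀ a δ k → a + ι (suc k) * δ ≡ (a + δ) + ι k * δ
  +[1+k]*δ a δ k = trans (cong (λ z → a + z * δ) (ι-suc k)) (step a δ (ι k))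

  half-gap : ∀ {q r} → q < r → ∃[ m ] ∃[ ε ] m < r × 0ℚ < ε × q + (ε + ε) ≡ m
  half-gap {q} q<r =
    let m , q<m , m<r = <-dense q<r
    in m , ½ * (m - q) , m<r , 0<half (0<diff q<m) ,
       trans (cong (λ z → q + z) (halves (m - q))) (add-sub q m)

  -‿mono : ∀ a b c d → a < c → d < b → a - b < c - d
  -‿mono a b c d a<c d<b = +-mono-< {a} {c} { - b} { - d} a<c (neg-antimono-< {d} {b} d<b)

  compare : ∀ a b ε q m → q + (ε + ε) ≡ m → q < a - (b + ε) ⊎ (a + ε) - b ≤ m
  compare a b ε q m q+2ε≡m = map₂
    (λ ≤q → subst₂ _≤_ (shift a b ε) q+2ε≡m (+-monoˡ-≤ (ε + ε) {a - (b + ε)} {q} ≤q))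
    (<-or-≥ q (a - (b + ε)))

  search : ∀ x δ → 0ℚ < δ → ∀ k a → Lower x a → Upper x (a + ι k * δ) →
           ∃[ a′ ] Lower x a′ × Upper x ((a′ + δ) + δ)
  search x δ 0<δ zero a La U = ⊥-elim (disjoint x La (subst (Upper x) (+0*δ a δ) U))
  search x δ 0<δ (suc k) a La U
    with located x (subst (_< (a + δ) + δ) (+-identityʳ (a + δ)) (+-monoʳ-< (a + δ) 0<δ))
  ... | inj₂ Ua   = a , La , Ua
  ... | inj₁ La+δ =
    search x δ 0<δ k (a + δ) La+δ (subst (Upper x) (+[1+k]*δ a δ k) U)

  approximate : ∀ x {ε} → 0ℚ < ε → ∃[ a ] Lower x a × Upper x (a + ε)
  approximate x {ε} 0<ε =
    let δ = ½ * ε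
        a , La = lower-inhabited x
        b , Ub = upper-inhabited x
        k , b-a≤kδ = archimedean (b - a) (0<half 0<ε)
        b≤ = subst (_≤ a + ι k * δ) (add-sub a b) (+-monoʳ-≤ a b-a≤kδ)
        a′ , La′ , Ua′ = search x δ (0<half 0<ε) k a La (upper-closed-≤ x b≤ Ub)
    in a′ , La′ , subst (Upper x)
         (trans (+-assoc a′ δ δ) (cong (λ z → a′ + z) (halves ε))) Ua′

open CutLemmas

fromℚ : ℚ → ℝ
fromℚ p .Lower q = q < p
fromℚ p .Upper q = p < q
fromℚ p .lower-inhabited = p - 1ℚ , q-1<q p
fromℚ p .upper-inhabited = p + 1ℚ , q<q+1 p
fromℚ p .lower-closed = <-trans
fromℚ p .upper-closed q<r p<q = <-trans p<q q<r
fromℚ p .lower-open q<p = let m , q<m , m<p = <-dense q<p in m , q<m , m<p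
fromℚ p .upper-open p<q = let m , p<m , m<q = <-dense p<q in m , m<q , p<m
fromℚ p .disjoint q<p p<q = <-irrefl refl (<-trans q<p p<q)
fromℚ p .located {q} {r} q<r with q <? p
... | yes q<p = inj₁ q<p
... | no  q≮p = inj₂ (≤-<-trans (≮⇒≥ q≮p) q<r)

fromℕ : ℕ → ℝ
fromℕ n = fromℚ (+ n / 1)

infixl 6 _-ℝ_

_-ℝ_ : ℝ → ℝ → ℝ
(x -ℝ y) .Lower q = ∃[ a ] ∃[ b ] Lower x a × Upper y b × q < a - b
(x -ℝ y) .Upper q = ∃[ a ] ∃[ b ] Upper x a × Lower y b × a - b < q
(x -ℝ y) .lower-inhabited =
  let a , La = lower-inhabited x
      b , Ub = upper-inhabited y
  in (a - b) - 1ℚ , a , b , La , Ub , q-1<q (a - b)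
(x -ℝ y) .upper-inhabited =
  let a , Ua = upper-inhabited x
      b , Lb = lower-inhabited y
  in (a - b) + 1ℚ , a , b , Ua , Lb , q<q+1 (a - b)
(x -ℝ y) .lower-closed q<r (a , b , La , Ub , r<) = a , b , La , Ub , <-trans q<r r<
(x -ℝ y) .upper-closed q<r (a , b , Ua , Lb , <q) = a , b , Ua , Lb , <-trans <q q<r
(x -ℝ y) .lower-open (a , b , La , Ub , q<) =
  let m , q<m , m< = <-dense q< in m , q<m , a , b , La , Ub , m<
(x -ℝ y) .upper-open (a , b , Ua , Lb , <q) =
  let m , <m , m<q = <-dense <q in m , m<q , a , b , Ua , Lb , <m
(x -ℝ y) .disjoint {q} (a , b , La , Ub , q<) (c , d , Uc , Ld , <q) =
  <-irrefl {q} refl (<-trans {q} {a - b} q<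
    (<-trans {a - b} {c - d}
      (-‿mono a b c d (lower<upper x La Uc) (lower<upper y Ld Ub)) <q))
(x -ℝ y) .located {q} {r} q<r = split (half-gap q<r)
  where
  decide : ∀ m a b ε → m < r → Lower x a → Upper x (a + ε) → Lower y b → Upper y (b + ε) →
           q < a - (b + ε) ⊎ (a + ε) - b ≤ m → Lower (x -ℝ y) q ⊎ Upper (x -ℝ y) r
  decide m a b ε m<r La Ua Lb Ub (inj₁ q<) = inj₁ (a , b + ε , La , Ub , q<)
  decide m a b ε m<r La Ua Lb Ub (inj₂ ≤m) =
    inj₂ (a + ε , b , Ua , Lb , ≤-<-trans {(a + ε) - b} {m} ≤m m<r)

  split : (∃[ m ] ∃[ ε ] m < r × 0ℚ < ε × q + (ε + ε) ≡ m) →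
          Lower (x -ℝ y) q ⊎ Upper (x -ℝ y) r
  split (m , ε , m<r , 0<ε , q+2ε≡m) = meet (approximate x 0<ε) (approximate y 0<ε)
    where
    meet : (∃[ a ] Lower x a × Upper x (a + ε)) → (∃[ b ] Lower y b × Upper y (b + ε)) →
           Lower (x -ℝ y) q ⊎ Upper (x -ℝ y) r
    meet (a , La , Ua) (b , Lb , Ub) =
      decide m a b ε m<r La Ua Lb Ub (compare a b ε q m q+2ε≡m)

infixr 7 _·_

_·_ : (c : ℚ) .{{_ : Positive c}} → ℝ → ℝ
_·_ c x = scaled
  where
  instance
    c≢0 = pos⇒nonZero c

  c⁻¹ = 1/ c

  0<c : 0ℚ < c
  0<c = positive⁻¹ c

  0<c⁻¹ : 0ℚ < c⁻¹
  0<c⁻¹ = positive⁻¹ c⁻¹ {{1/pos⇒pos c}}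

  cancel : ∀ q → c * (c⁻¹ * q) ≡ q
  cancel q = trans (sym (*-assoc c c⁻¹ q))
                   (trans (cong (_* q) (*-inverseʳ c)) (*-identityˡ q))

  cancel′ : ∀ q → c⁻¹ * (c * q) ≡ q
  cancel′ q = trans (sym (*-assoc c⁻¹ c q))
                    (trans (cong (_* q) (*-inverseˡ c)) (*-identityˡ q))

  scaled : ℝ
  scaled .Lower q = Lower x (c⁻¹ * q)
  scaled .Upper q = Upper x (c⁻¹ * q)
  scaled .lower-inhabited =
    let a , La = lower-inhabited x in c * a , subst (Lower x) (sym (cancel′ a)) La
  scaled .upper-inhabited =
    let a , Ua = upper-inhabited x in c * a , subst (Upper x) (sym (cancel′ a)) Ua
  scaled .lower-closed q<r = lower-closed x (*-monoˡ 0<c⁻¹ q<r)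
  scaled .upper-closed q<r = upper-closed x (*-monoˡ 0<c⁻¹ q<r)
  scaled .lower-open {q} Lq =
    let a , <a , La = lower-open x Lq
    in c * a , subst (_< c * a) (cancel q) (*-monoˡ 0<c <a) ,
       subst (Lower x) (sym (cancel′ a)) La
  scaled .upper-open {q} Uq =
    let a , a< , Ua = upper-open x Uq
    in c * a , subst (c * a <_) (cancel q) (*-monoˡ 0<c a<) ,
       subst (Upper x) (sym (cancel′ a)) Ua
  scaled .disjoint = disjoint x
  scaled .located q<r = located x (*-monoˡ 0<c⁻¹ q<r)

-- The nonnegative n-th root, for n ≥ 1.  It is total: for x < 0 the cut below
-- is the one of 0, so that `root n x` is the n-th root of max(x, 0).

root : (n : ℕ) .{{_ : NonZero n}} → ℝ → ℝ
root n x .Lower q = q < 0ℚ ⊎ (0ℚ ≤ q × Lower x (q ^ n))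
root n x .Upper q = 0ℚ < q × Upper x (q ^ n)
root n x .lower-inhabited = - 1ℚ , inj₁ (negative⁻¹ (- 1ℚ))
root n x .upper-inhabited =
  let u , Uu = upper-inhabited x
      1≤m = p≤q⊔p u 1ℚ
  in u ⊔ 1ℚ , <-≤-trans 0<1 1≤m ,
     upper-closed-≤ x (≤-trans (p≤p⊔q u 1ℚ) (^-dominates n 1≤m)) Uu
root n x .lower-closed q<r (inj₁ r<0) = inj₁ (<-trans q<r r<0)
root n x .lower-closed {q} q<r (inj₂ (0≤r , Lrⁿ)) with q <? 0ℚ
... | yes q<0 = inj₁ q<0
... | no  q≮0 = inj₂ (≮⇒≥ q≮0 , lower-closed x (^-mono-< n (≮⇒≥ q≮0) q<r) Lrⁿ)
root n x .upper-closed q<r (0<q , Uqⁿ) =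
  <-trans 0<q q<r , upper-closed x (^-mono-< n (<⇒≤ 0<q) q<r) Uqⁿ
root n x .lower-open (inj₁ q<0) =
  let m , q<m , m<0 = <-dense q<0 in m , q<m , inj₁ m<0
root n x .lower-open (inj₂ (0≤q , Lqⁿ)) =
  let s , qⁿ<s , Ls = lower-open x Lqⁿ
      r , q<r , rⁿ<s = ^-cont-above n 0≤q qⁿ<s
  in r , q<r , inj₂ (<⇒≤ (≤-<-trans 0≤q q<r) , lower-closed x rⁿ<s Ls)
root n x .upper-open (0<q , Uqⁿ) =
  let s , s<qⁿ , Us = upper-open x Uqⁿ
      r , 0<r , r<q , s<rⁿ = ^-cont-below n 0<q s<qⁿ
  in r , r<q , 0<r , upper-closed x s<rⁿ Us
root n x .disjoint (inj₁ q<0) (0<q , _) = <-irrefl refl (<-trans q<0 0<q)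
root n x .disjoint (inj₂ (_ , Lqⁿ)) (_ , Uqⁿ) = disjoint x Lqⁿ Uqⁿ
root n x .located {q} q<r with q <? 0ℚ
... | yes q<0 = inj₁ (inj₁ q<0)
... | no  q≮0 with located x (^-mono-< n (≮⇒≥ q≮0) q<r)
...   | inj₁ Lqⁿ = inj₁ (inj₂ (≮⇒≥ q≮0 , Lqⁿ))
...   | inj₂ Urⁿ = inj₂ (≤-<-trans (≮⇒≥ q≮0) q<r , Urⁿ)

------------------------------------------------------------------------
-- Korselt numbers with three (not necessarily prime) factors.
-- Since 1 < p < q < r, no truncation occurs in the subtractions below.

record K₃N (n : ℕ) : Set where
  field
    p q r     : ℕ
    n≡pqr     : n ≡ p ℕ.* q ℕ.* r
    1<p       : 1 ℕ.< p
    p<q       : p ℕ.< q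
    q<r       : q ℕ.< r
    p-odd     : 2 ∤ p
    q-odd     : 2 ∤ q
    r-odd     : 2 ∤ r
    p-1∣n-1   : p ℕ.∸ 1 ∣ n ℕ.∸ 1
    q-1∣n-1   : q ℕ.∸ 1 ∣ n ℕ.∸ 1
    r-1∣n-1   : r ℕ.∸ 1 ∣ n ℕ.∸ 1

  1<r : 1 ℕ.< r
  1<r = ℕ.<-trans 1<p (ℕ.<-trans p<q q<r)

  instance
    p-1≢0 : NonZero (p ℕ.∸ 1)
    p-1≢0 = ℕ.>-nonZero (ℕ.m<n⇒0<n∸m 1<p)

    r-1≢0 : NonZero (r ℕ.∸ 1)
    r-1≢0 = ℕ.>-nonZero (ℕ.m<n⇒0<n∸m 1<r)

  E : ℕ
  E = (p ℕ.* q ℕ.∸ 1) ℕ./ (r ℕ.∸ 1)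

  field
    E≥2 : E ℕ.≥ 2

  H : ℕ
  H = gcd (p ℕ.∸ 1) (gcd (q ℕ.∸ 1) (r ℕ.∸ 1))

  instance
    H≢0 : NonZero H
    H≢0 = ℕ.≢-nonZero (gcd[m,n]≢0 (p ℕ.∸ 1) _ (inj₁ (ℕ.≢-nonZero⁻¹ (p ℕ.∸ 1))))

  A : ℕ
  A = (p ℕ.∸ 1) ℕ./ H

  -- The divisions defining A and E are exact.

  A*H≡p-1 : A ℕ.* H ≡ p ℕ.∸ 1
  A*H≡p-1 = m/n*n≡m (gcd[m,n]∣m (p ℕ.∸ 1) _)

  E*[r-1]≡pq-1 : E ℕ.* (r ℕ.∸ 1) ≡ p ℕ.* q ℕ.∸ 1
  E*[r-1]≡pq-1 = m/n*n≡m (∣m+n∣m⇒∣n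
    (subst (r ℕ.∸ 1 ∣_) n-1≡ r-1∣n-1) (n∣m*n (p ℕ.* q)))
    where
    pq = p ℕ.* q

    1≤pq : 1 ℕ.≤ pq
    1≤pq = ℕ.*-mono-≤ (ℕ.<⇒≤ 1<p) (ℕ.<⇒≤ (ℕ.<-trans 1<p p<q))

    pqr≡ : pq ℕ.* r ≡ pq ℕ.* (r ℕ.∸ 1) ℕ.+ pq
    pqr≡ = trans (cong (λ z → pq ℕ.* z) (sym (ℕ.m∸n+n≡m (ℕ.<⇒≤ 1<r))))
      (trans (ℕ.*-distribˡ-+ pq (r ℕ.∸ 1) 1)
             (cong (λ z → pq ℕ.* (r ℕ.∸ 1) ℕ.+ z) (ℕ.*-identityʳ pq)))

    n-1≡ : n ℕ.∸ 1 ≡ pq ℕ.* (r ℕ.∸ 1) ℕ.+ (pq ℕ.∸ 1)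
    n-1≡ = trans (cong (ℕ._∸ 1) (trans n≡pqr pqr≡))
                 (ℕ.+-∸-assoc (pq ℕ.* (r ℕ.∸ 1)) 1≤pq)

{-# OPTIONS --safe #-}

-- Write p − 1 = HA, q − 1 = HB, r − 1 = HC.  Each of A, B, C divides (n − 1)/H, which
-- makes them pairwise coprime, and hence H(AB + BC + CA) + (A + B + C) = K·ABC for some
-- K ≥ 1.  As H is even, this gives KA < 3H.  Put d = 3H − A > 0.  Squaring twice, the
-- claim becomes A d² > H (A/2 + 1/192), which is easy for d > A (in particular for K ≥ 2)
-- and amounts to 2d² > H for d ≤ A.  In the remaining case K = 1, put B = A + b and
-- C = A + c.  The cubic relation forces b + c > 3d and then, by bc ≥ b + c − 1, also
-- A ≤ 6d² − 4d + O(1), whereas 2d² ≤ H means A ≥ 6d² − d.  These are incompatible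
-- except for finitely many pairs with d ≤ 3, of which the parity of H leaves only
-- A = 5, 11, 22, 51.

module Submission where

open import Defs
open import Data.Nat.Base using (ℕ; _∸_; _*_)
open import Data.Integer.Base using (+_)
open import Data.Rational.Base using (½; _/_)
open import Data.Nat.Base using (zero; suc; _+_; _≤_; _<_; z≤n; s≤s; NonZero; >-nonZero)
open import Data.Nat.Properties
open import Data.Nat.Divisibility
open import Data.Nat.Coprimality using (Coprime; coprime-divisor)
open import Data.Nat.GCD using (gcd; gcd[m,n]∣m; gcd[m,n]∣n; gcd-greatest)
open import Data.Nat.Tactic.RingSolver using (solve-∀)
import Data.Integer.Base as ℤ
import Data.Integer.Properties as ℤ
open import Data.Rational.Base using (ℚ; 0ℚ; 1ℚ; toℚᵘ; *<*)
import Data.Rational.Base as ℚ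
import Data.Rational.Properties as ℚ
import Data.Rational.Unnormalised.Base as ℚᵘ
import Data.Rational.Unnormalised.Properties as ℚᵘ
open import Data.Rational.Solver using (module +-*-Solver)
open import Algebra.Definitions.RawSemiring ℚ.+-*-rawSemiring using (_^_)
open import Data.Product.Base using (∃-syntax; _×_; _,_)
open import Data.Sum.Base using (inj₁; inj₂)
open import Data.Empty using (⊥; ⊥-elim)
open import Relation.Nullary.Decidable using (yes; no; from-no; from-yes)
open import Relation.Binary.PropositionalEquality

open CutLemmas using (ι; ι-suc; recip; ^-cont-above; q*[s*i]≡s)
open +-*-Solver using (solve; _:+_; _:*_; _:-_; _:=_; con)

-- Elementary inequalities in ℕ and the integer square root.

m<n⇒∃[o]m+1+o≡n : ∀ {m n} → m < n → ∃[ o ] m + suc o ≡ n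
m<n⇒∃[o]m+1+o≡n {m} m<n with m≤n⇒∃[o]m+o≡n m<n
... | o , eq = o , trans (+-suc m o) eq

2*m*n≤m*m+n*n : ∀ m n → 2 * (m * n) ≤ m * m + n * n
2*m*n≤m*m+n*n m n with ≤-total m n
... | inj₁ m≤n with m≤n⇒∃[o]m+o≡n m≤n
...   | k , refl = ≤-trans (m≤m+n _ (k * k)) (≤-reflexive (square m k))
  where
  square : ∀ m k → 2 * (m * (m + k)) + k * k ≡ m * m + (m + k) * (m + k)
  square = solve-∀
2*m*n≤m*m+n*n m n | inj₂ n≤m with m≤n⇒∃[o]m+o≡n n≤m
...   | k , refl = ≤-trans (m≤m+n _ (k * k)) (≤-reflexive (square n k))
  where
  square : ∀ n k → 2 * ((n + k) * n) + k * k ≡ (n + k) * (n + k) + n * n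
  square = solve-∀

floor-sqrt : ∀ n → ∃[ w ] w * w ≤ n × n < suc w * suc w
floor-sqrt zero = 0 , z≤n , s≤s z≤n
floor-sqrt (suc n) with floor-sqrt n
... | w , w²≤n , n< with suc n <? suc w * suc w
...   | yes 1+n< = w , m≤n⇒m≤1+n w²≤n , 1+n<
...   | no  1+n≮ = suc w , ≮⇒≥ 1+n≮ ,
  ≤-<-trans n< (*-mono-< (n<1+n (suc w)) (n<1+n (suc w)))

-- The claim as a pair of integer inequalities, and its two ranges.

-- M / N is a rational number strictly between (P/12)^(1/4) and 2 (√(3P) − A).

Separated : (A P : ℕ) → Set
Separated A P = ∃[ M ] ∃[ N ] 0 < M × 0 < N ×
  P * (N * N * (N * N)) < 12 * (M * M * (M * M)) ×
  (2 * (A * N) + M) * (2 * (A * N) + M) < 12 * P * (N * N)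

-- The witness is `w`, the integer part of √P for P = AH. The fourth power has ample room, since P <
-- (w + 1)² ≤ 12w⁴ for w ≥ 1. For the square, 2Aw ≤ A² + w² gives (2A + w)² ≤ 6A² + 3w² < 9AH + 3P =
-- 12P.
separated-wide : ∀ A H → 0 < A → 2 * A < 3 * H → Separated A (A * H)
separated-wide A H 0<A 2A<3H with floor-sqrt (A * H)
... | zero , _ , P<1 = ⊥-elim (<⇒≱ P<1 (*-mono-≤ 0<A 0<H))
  where
  0<H : 0 < H
  0<H = *-cancelˡ-< 3 0 H (≤-<-trans z≤n 2A<3H)
... | w@(suc k) , w²≤P , P< = w , 1 , s≤s z≤n , s≤s z≤n , lower , upper
  where
  open ≤-Reasoning
  P = A * H
  instance
    3A≢0 : NonZero (3 * A)
    3A≢0 = >-nonZero (*-mono-≤ {1} {3} (s≤s z≤n) 0<A)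

  quartic : ∀ k → suc (suc k) * suc (suc k) +
            (8 + 44 * k + 71 * (k * k) + 48 * (k * k * k) + 12 * (k * k * k * k))
            ≡ 12 * (suc k * suc k * (suc k * suc k))
  quartic = solve-∀

  lower : P * 1 < 12 * (w * w * (w * w))
  lower = begin-strict
    P * 1          ≡⟨ *-identityʳ P ⟩
    P              <⟨ P< ⟩
    suc w * suc w  ≤⟨ m≤m+n _ _ ⟩
    _              ≡⟨ quartic k ⟩
    12 * (w * w * (w * w))     ∎

  expand : ∀ A w → (2 * (A * 1) + w) * (2 * (A * 1) + w) ≡ 4 * (A * A) + 2 * (2 * (A * w)) + w * w
  expand = solve-∀
  regroup : ∀ A w → 4 * (A * A) + 2 * (A * A + w * w) + w * w ≡ 3 * A * (2 * A) + 3 * (w * w)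
  regroup = solve-∀
  collect : ∀ A H → 3 * A * (3 * H) + 3 * (A * H) ≡ 12 * (A * H) * (1 * 1)
  collect = solve-∀

  upper : (2 * (A * 1) + w) * (2 * (A * 1) + w) < 12 * P * (1 * 1)
  upper = begin-strict
    (2 * (A * 1) + w) * (2 * (A * 1) + w)
      ≡⟨ expand A w ⟩
    4 * (A * A) + 2 * (2 * (A * w)) + w * w
      ≤⟨ +-monoˡ-≤ (w * w) (+-monoʳ-≤ (4 * (A * A)) (*-monoʳ-≤ 2 (2*m*n≤m*m+n*n A w))) ⟩
    4 * (A * A) + 2 * (A * A + w * w) + w * w
      ≡⟨ regroup A w ⟩
    3 * A * (2 * A) + 3 * (w * w)
      <⟨ +-mono-<-≤ (*-monoʳ-< (3 * A) 2A<3H) (*-monoʳ-≤ 3 w²≤P) ⟩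
    3 * A * (3 * H) + 3 * P
      ≡⟨ collect A H ⟩
    12 * P * (1 * 1) ∎

-- With S = √(3P) = √(A (A + d)), the witness is the second-order expansion
-- d − d²/(4A) of 2 (S − A).

separated-narrow : ∀ A d H → 0 < d → d ≤ A → A + d ≡ 3 * H → A + d + 6 ≤ 6 * (d * d) →
                   Separated A (A * H)
separated-narrow A d H 0<d d≤A A+d≡3H A+d+6≤6d² with m≤n⇒∃[o]m+o≡n d≤A
... | x , refl = d * e , 4 * A , *-mono-≤ 0<d (<-≤-trans 0<d d≤e) , *-mono-≤ {1} {4} (s≤s z≤n) 0<A ,
                 *-cancelˡ-< 3 _ _ lower , upper
  where
  open ≤-Reasoning
  e P Z M N : ℕ
  -- As A = d + x, this is 4A - d without a subtraction, so that M / N = d - d²/(4A).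
  e = 3 * d + 4 * x
  P = A * H
  -- Chosen so that 2Z = N²(A + d/2). As √(A(A + d)) ≤ A + d/2, this bounds N²√(3P), and `lower`
  -- reduces to 2Z < 6M².
  Z = 4 * (A * A) * (2 * A + d)
  M = d * e
  N = 4 * A

  d≤e : d ≤ e
  d≤e = ≤-trans (m≤m+n d (2 * d)) (m≤m+n (3 * d) (4 * x))
  0<A : 0 < A
  0<A = <-≤-trans 0<d d≤A

  3P≡ : 3 * P ≡ A * (A + d)
  3P≡ = trans (trans (sym (*-assoc 3 A H)) (trans (cong (_* H) (*-comm 3 A)) (*-assoc A 3 H)))
              (cong (A *_) (sym A+d≡3H))

  Z<3M² : Z < 3 * (M * M)
  Z<3M² = begin-strict
    -- The lower bound 4A(2A - d)(A + d + 6) + 3d⁴ for 3M² exceeds Z by 24A² + 24Ax + 3d⁴ - 4Ad².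
    -- Adding 4Ad² to both sides removes the negative term, and 2Ad² ≤ A² + d⁴ absorbs it.
    Z <⟨ +-cancelʳ-< (2 * (2 * (A * (d * d)))) Z _ (begin-strict
      Z + 2 * (2 * (A * (d * d)))
        ≤⟨ +-monoʳ-≤ Z (*-monoʳ-≤ 2 (2*m*n≤m*m+n*n A (d * d))) ⟩
      Z + 2 * (A * A + d * d * (d * d))
        <⟨ +-monoʳ-< Z (m<m+n _ (<-≤-trans (*-mono-< 0<A 0<A) (m≤m+n _ _))) ⟩
      Z + (2 * (A * A + d * d * (d * d)) + (A * A + (21 * (A * A) + 24 * (A * x) + d * d * (d * d))))
        ≡⟨ id₁ d x ⟩
      4 * (A * (d + 2 * x)) * (A + d + 6) + 3 * (d * d * (d * d)) + 2 * (2 * (A * (d * d))) ∎) ⟩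
    4 * (A * (d + 2 * x)) * (A + d + 6) + 3 * (d * d * (d * d))
      ≤⟨ +-monoˡ-≤ _ (*-monoʳ-≤ (4 * (A * (d + 2 * x))) A+d+6≤6d²) ⟩
    4 * (A * (d + 2 * x)) * (6 * (d * d)) + 3 * (d * d * (d * d))
      ≡⟨ id₂ d x ⟩
    3 * (M * M) ∎
    where
    id₁ : ∀ d x →
      4 * ((d + x) * (d + x)) * (2 * (d + x) + d) + (2 * ((d + x) * (d + x) + d * d * (d * d)) +
        ((d + x) * (d + x) + (21 * ((d + x) * (d + x)) + 24 * ((d + x) * x) + d * d * (d * d)))) ≡
      4 * ((d + x) * (d + 2 * x)) * (d + x + d + 6) + 3 * (d * d * (d * d)) + 2 * (2 * ((d + x) * (d * d)))
    id₁ = solve-∀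
    id₂ : ∀ d x → 4 * ((d + x) * (d + 2 * x)) * (6 * (d * d)) + 3 * (d * d * (d * d)) ≡
                  3 * (d * (3 * d + 4 * x) * (d * (3 * d + 4 * x)))
    id₂ = solve-∀

  lower : 3 * (P * (N * N * (N * N))) < 3 * (12 * (M * M * (M * M)))
  lower = begin-strict
    3 * (P * (N * N * (N * N)))             ≡⟨ *-assoc 3 P ((N * N * (N * N))) ⟨
    3 * P * (N * N * (N * N))               ≡⟨ cong (_* (N * N * (N * N))) 3P≡ ⟩
    A * (A + d) * (N * N * (N * N))         ≤⟨ m≤m+n _ (64 * ((A * A * (A * A)) * (d * d))) ⟩
    A * (A + d) * (N * N * (N * N)) + 64 * ((A * A * (A * A)) * (d * d)) ≡⟨ id₁ A d ⟩
    4 * (Z * Z)                 <⟨ *-monoʳ-< 4 (*-mono-< Z<3M² Z<3M²) ⟩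
    4 * (3 * (M * M) * (3 * (M * M))) ≡⟨ id₂ M ⟩
    3 * (12 * (M * M * (M * M)))            ∎
    where
    id₁ : ∀ A d → A * (A + d) * (4 * A * (4 * A) * (4 * A * (4 * A))) +
                  64 * ((A * A * (A * A)) * (d * d)) ≡
                  4 * (4 * (A * A) * (2 * A + d) * (4 * (A * A) * (2 * A + d)))
    id₁ = solve-∀
    id₂ : ∀ M → 4 * (3 * (M * M) * (3 * (M * M))) ≡ 3 * (12 * (M * M * (M * M)))
    id₂ = solve-∀

  upper : (2 * (A * N) + M) * (2 * (A * N) + M) < 12 * P * (N * N)
  upper = begin-strict
    (2 * (A * N) + M) * (2 * (A * N) + M)
      -- The square falls short of 12PN² by exactly d³(8A - d).
      <⟨ m<m+n _ (*-mono-< (*-mono-< 0<d (*-mono-< 0<d 0<d))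
                            (<-≤-trans (*-mono-< {0} {7} (s≤s z≤n) 0<d) (m≤m+n _ (8 * x)))) ⟩
    (2 * (A * N) + M) * (2 * (A * N) + M) + d * (d * d) * (7 * d + 8 * x)
      ≡⟨ id₁ d x ⟩
    4 * (A * (A + d)) * (N * N)
      ≡⟨ cong (λ z → 4 * z * (N * N)) 3P≡ ⟨
    4 * (3 * P) * (N * N)
      ≡⟨ cong (_* (N * N)) (*-assoc 4 3 P) ⟨
    12 * P * (N * N) ∎
    where
    id₁ : ∀ d x → let T = 2 * ((d + x) * (4 * (d + x))) + d * (3 * d + 4 * x) in
                  T * T + d * (d * d) * (7 * d + 8 * x) ≡
                  4 * ((d + x) * (d + x + d)) * (4 * (d + x) * (4 * (d + x)))
    id₁ = solve-∀

-- The case K = 1: excluding the balanced equation.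

-- For τ = 0 the sum is a multiple of α, and for τ ≥ 1 it is at least β > k.
α∤k⇒αw+βτ≢k : ∀ {α β k} w τ → α ∤ k → k < β → α * w + β * τ ≢ k
α∤k⇒αw+βτ≢k {α} {β} w zero α∤k _ eq = α∤k (divides w
  (trans (sym eq) (trans (cong (λ z → α * w + z) (*-zeroʳ β)) (trans (+-identityʳ _) (*-comm α w)))))
α∤k⇒αw+βτ≢k {α} {β} {k} w (suc τ) _ k<β eq = <⇒≢ (<-≤-trans k<β (begin
  β                   ≤⟨ m≤m*n β (suc τ) ⟩
  β * suc τ           ≤⟨ m≤n+m _ (α * w) ⟩
  α * w + β * suc τ   ∎)) (sym eq)
  where open ≤-Reasoning

-- This is what A = 5, d = 1 leaves. Since τ = 0, bc = 5 would solve the equation, the sum b + c has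
-- to enter: for τ = 0 it allows only bc ≤ 1.
9w+21τ≢45 : ∀ b c τ → b + c ≡ τ + 2 → 9 * (b * c) + 21 * τ ≢ 45
9w+21τ≢45 0 c 0 _    ()
9w+21τ≢45 1 .1 0 refl ()
9w+21τ≢45 2 .0 0 refl ()
9w+21τ≢45 b c 1 _ eq =
  -- The second unknown is 0 here, so 25 serves only as a bound above 24.
  α∤k⇒αw+βτ≢k {9} {25} {24} (b * c) 0 (from-no (9 ∣? 24)) ≤-refl
    (+-cancelˡ-≡ 21 _ _ (trans (id (b * c)) eq))
  where
  id : ∀ w → 21 + (9 * w + 25 * 0) ≡ 9 * w + 21 * 1
  id = solve-∀
9w+21τ≢45 b c (suc (suc τ)) _ eq =
  α∤k⇒αw+βτ≢k {9} {21} {3} (b * c) τ (from-no (9 ∣? 3)) (from-yes (3 <? 21))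
    (+-cancelˡ-≡ 42 _ _ (trans (id (b * c) τ) eq))
  where
  id : ∀ w τ → 42 + (9 * w + 21 * τ) ≡ 9 * w + 21 * (2 + τ)
  id = solve-∀

-- The equation 3ABC = (A + d)(AB + BC + CA) + 3(A + B + C) for B = A + b and
-- C = A + c, where b + c = 3d + 1 + τ and bc = b + c − 1 + w.

Balanced : (A d τ w : ℕ) → Set
Balanced A d τ w = A * A * (1 + τ) + 2 * (3 * d + τ + w) * A ≡
  2 * (d * (3 * d + 1 + τ)) * A + d * (3 * d + τ + w) + 9 * A + 3 * (3 * d + 1 + τ)

-- For A = 6d² − d + 6g the terms of highest order cancel.

unbalanced : ∀ A d g e τ w → A + d ≡ 6 * (d * d + g) → 9 + e ≡ 6 * g + 3 * d → 0 < d →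
  9 * d ≤ 6 * (d * d + g) → 3 * (d * d) + 9 * d + 3 < 8 * d * e → Balanced A d τ w → ⊥
unbalanced A d g e τ w A+d≡ 9+e≡ 0<d 9d≤ <8de eq = <⇒≢ rhs<lhs (cong (λ z → A * d + z) (sym eq))
  where
  open ≤-Reasoning
  lhs rhs : ℕ
  lhs = A * A * (1 + τ) + 2 * (3 * d + τ + w) * A
  rhs = 2 * (d * (3 * d + 1 + τ)) * A + d * (3 * d + τ + w) + 9 * A + 3 * (3 * d + 1 + τ)

  8d≤A : 8 * d ≤ A
  8d≤A = +-cancelˡ-≤ d _ _ (≤-trans 9d≤ (≤-reflexive (trans (sym A+d≡) (+-comm A d))))

  quadratic : 2 * d * A + (d + 3) ≤ A * (A + 2)
  quadratic = begin
    2 * d * A + (d + 3)        ≤⟨ +-monoʳ-≤ (2 * d * A) (+-monoʳ-≤ d (*-monoʳ-≤ 3 0<d)) ⟩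
    2 * d * A + (d + 3 * d)    ≤⟨ m≤m+n _ (6 * d * A + 4 * d) ⟩
    2 * d * A + (d + 3 * d) + (6 * d * A + 4 * d)  ≡⟨ collect A d ⟩
    8 * d * A + 8 * d          ≤⟨ +-mono-≤ (*-monoˡ-≤ A 8d≤A) 8d≤A ⟩
    A * A + A                  ≤⟨ m≤m+n _ A ⟩
    A * A + A + A              ≡⟨ factor A ⟩
    A * (A + 2)                ∎
    where
    collect : ∀ A d → 2 * d * A + (d + 3 * d) + (6 * d * A + 4 * d) ≡ 8 * d * A + 8 * d
    collect = solve-∀
    factor : ∀ A → A * A + A + A ≡ A * (A + 2)
    factor = solve-∀

  dw≤2wA : d * w ≤ 2 * w * A
  dw≤2wA = begin
    d * w        ≤⟨ *-monoˡ-≤ w (≤-trans (m≤m+n d (7 * d)) 8d≤A) ⟩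
    A * w        ≡⟨ *-comm A w ⟩
    w * A        ≤⟨ *-monoˡ-≤ A (m≤m+n w (w + 0)) ⟩
    2 * w * A    ∎

  -- With Ad added to both sides, A(A + d) = 6A(d² + g) appears in `lhs`. The coefficient of A then
  -- has the surplus 6g + 3d - 9 = e, and Ae ≥ 8de exceeds the constant 3d² + 9d + 3. The parts in τ
  -- and w compare through `quadratic` and `dw≤2wA`.
  rhs<lhs : A * d + rhs < A * d + lhs
  rhs<lhs = begin-strict
    A * d + rhs
      ≡⟨ splitʳ A d τ w ⟩
    A * (6 * (d * d) + 3 * d + 9) + (3 * (d * d) + 9 * d + 3 + (τ * (2 * d * A + (d + 3)) + d * w))
      <⟨ +-monoʳ-< (A * (6 * (d * d) + 3 * d + 9))
           (+-mono-<-≤ (<-≤-trans <8de (*-monoˡ-≤ e 8d≤A)) (+-mono-≤ (*-monoʳ-≤ τ quadratic) dw≤2wA)) ⟩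
    A * (6 * (d * d) + 3 * d + 9) + (A * e + (τ * (A * (A + 2)) + 2 * w * A))
      ≡⟨ group A d e τ w ⟩
    A * (6 * (d * d) + 3 * d) + A * (9 + e) + τ * (A * (A + 2)) + 2 * w * A
      ≡⟨ cong (λ z → A * (6 * (d * d) + 3 * d) + A * z + τ * (A * (A + 2)) + 2 * w * A) 9+e≡ ⟩
    A * (6 * (d * d) + 3 * d) + A * (6 * g + 3 * d) + τ * (A * (A + 2)) + 2 * w * A
      ≡⟨ regroup A d g τ w ⟩
    A * (6 * (d * d + g)) + (A * A * τ + 2 * (3 * d + τ + w) * A)
      ≡⟨ cong (λ z → A * z + (A * A * τ + 2 * (3 * d + τ + w) * A)) A+d≡ ⟨
    A * (A + d) + (A * A * τ + 2 * (3 * d + τ + w) * A)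
      ≡⟨ splitˡ A d τ w ⟩
    A * d + lhs ∎
    where
    splitʳ : ∀ A d τ w → A * d +
      (2 * (d * (3 * d + 1 + τ)) * A + d * (3 * d + τ + w) + 9 * A + 3 * (3 * d + 1 + τ)) ≡
      A * (6 * (d * d) + 3 * d + 9) + (3 * (d * d) + 9 * d + 3 + (τ * (2 * d * A + (d + 3)) + d * w))
    splitʳ = solve-∀
    group : ∀ A d e τ w →
      A * (6 * (d * d) + 3 * d + 9) + (A * e + (τ * (A * (A + 2)) + 2 * w * A)) ≡
      A * (6 * (d * d) + 3 * d) + A * (9 + e) + τ * (A * (A + 2)) + 2 * w * A
    group = solve-∀
    regroup : ∀ A d g τ w →
      A * (6 * (d * d) + 3 * d) + A * (6 * g + 3 * d) + τ * (A * (A + 2)) + 2 * w * A ≡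
      A * (6 * (d * d + g)) + (A * A * τ + 2 * (3 * d + τ + w) * A)
    regroup = solve-∀
    splitˡ : ∀ A d τ w →
      A * (A + d) + (A * A * τ + 2 * (3 * d + τ + w) * A) ≡
      A * d + (A * A * (1 + τ) + 2 * (3 * d + τ + w) * A)
    splitˡ = solve-∀

+-cancel-excess : ∀ {m n} x y → m ≡ n → m + x ≡ n + y → x ≡ y
+-cancel-excess {m} x y refl = +-cancelˡ-≡ m x y

-- Here b and c are one less than the differences B - A and C - A, whence w = bc. The lemma
-- `unbalanced` applies as soon as e = 6g + 3d - 9 is positive. This fails for exactly four pairs
-- (d, g), which come first, each with an explicit A.
¬balanced : ∀ A d g τ b c → 0 < d → A + d ≡ 6 * (d * d + g) → suc b + c ≡ 3 * d + τ →
  Balanced A d τ (b * c) → ⊥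
¬balanced A 1 0 τ b c _ A+d≡ b+c≡ eq with +-cancelʳ-≡ 1 A 5 A+d≡
... | refl = 9w+21τ≢45 b c τ (suc-injective (trans b+c≡ (cong suc (+-comm 2 τ))))
  (sym (+-cancel-excess 45 _ eq (excess τ (b * c))))
  where
  -- At A = 5, d = 1 the two sides of `Balanced` differ by 9w + 21τ - 45. The next three cases
  -- follow the same pattern.
  excess : ∀ τ w → 5 * 5 * (1 + τ) + 2 * (3 * 1 + τ + w) * 5 + 45 ≡
    2 * (1 * (3 * 1 + 1 + τ)) * 5 + 1 * (3 * 1 + τ + w) + 9 * 5 + 3 * (3 * 1 + 1 + τ) + (9 * w + 21 * τ)
  excess = solve-∀
¬balanced A 1 1 τ b c _ A+d≡ b+c≡ eq with +-cancelʳ-≡ 1 A 11 A+d≡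
... | refl = α∤k⇒αw+βτ≢k {21} {117} {15} (b * c) τ (from-no (21 ∣? 15)) (from-yes (15 <? 117))
  (sym (+-cancel-excess 15 _ eq (excess τ (b * c))))
  where
  excess : ∀ τ w → 11 * 11 * (1 + τ) + 2 * (3 * 1 + τ + w) * 11 + 15 ≡
    2 * (1 * (3 * 1 + 1 + τ)) * 11 + 1 * (3 * 1 + τ + w) + 9 * 11 + 3 * (3 * 1 + 1 + τ) + (21 * w + 117 * τ)
  excess = solve-∀
¬balanced A 2 0 τ b c _ A+d≡ b+c≡ eq with +-cancelʳ-≡ 2 A 22 A+d≡
... | refl = α∤k⇒αw+βτ≢k {42} {435} {99} (b * c) τ (from-no (42 ∣? 99)) (from-yes (99 <? 435))
  (sym (+-cancel-excess 99 _ eq (excess τ (b * c))))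
  where
  excess : ∀ τ w → 22 * 22 * (1 + τ) + 2 * (3 * 2 + τ + w) * 22 + 99 ≡
    2 * (2 * (3 * 2 + 1 + τ)) * 22 + 2 * (3 * 2 + τ + w) + 9 * 22 + 3 * (3 * 2 + 1 + τ) + (42 * w + 435 * τ)
  excess = solve-∀
¬balanced A 3 0 τ b c _ A+d≡ b+c≡ eq with +-cancelʳ-≡ 3 A 51 A+d≡
... | refl = α∤k⇒αw+βτ≢k {99} {2391} {57} (b * c) τ (from-no (99 ∣? 57)) (from-yes (57 <? 2391))
  (sym (+-cancel-excess 57 _ eq (excess τ (b * c))))
  where
  excess : ∀ τ w → 51 * 51 * (1 + τ) + 2 * (3 * 3 + τ + w) * 51 + 57 ≡
    2 * (3 * (3 * 3 + 1 + τ)) * 51 + 3 * (3 * 3 + τ + w) + 9 * 51 + 3 * (3 * 3 + 1 + τ) + (99 * w + 2391 * τ)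
  excess = solve-∀
¬balanced A 1 (suc (suc g)) τ b c 0<d A+d≡ b+c≡ eq =
  unbalanced A 1 (2 + g) (6 + 6 * g) τ (b * c) A+d≡ (9+e≡ g) 0<d
    (≤-trans (m≤m+n 9 (9 + 6 * g)) (≤-reflexive (9d≤ g)))
    (<-≤-trans (m≤m+n 16 (32 + 48 * g)) (≤-reflexive (<8de g))) eq
  where
  9+e≡ : ∀ g → 9 + (6 + 6 * g) ≡ 6 * (2 + g) + 3 * 1
  9+e≡ = solve-∀
  9d≤ : ∀ g → 9 + (9 + 6 * g) ≡ 6 * (1 * 1 + (2 + g))
  9d≤ = solve-∀
  <8de : ∀ g → 16 + (32 + 48 * g) ≡ 8 * 1 * (6 + 6 * g)
  <8de = solve-∀
¬balanced A 2 (suc g) τ b c 0<d A+d≡ b+c≡ eq =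
  unbalanced A 2 (1 + g) (3 + 6 * g) τ (b * c) A+d≡ (9+e≡ g) 0<d
    (≤-trans (m≤m+n 18 (12 + 6 * g)) (≤-reflexive (9d≤ g)))
    (<-≤-trans (m≤m+n 34 (14 + 96 * g)) (≤-reflexive (<8de g))) eq
  where
  9+e≡ : ∀ g → 9 + (3 + 6 * g) ≡ 6 * (1 + g) + 3 * 2
  9+e≡ = solve-∀
  9d≤ : ∀ g → 18 + (12 + 6 * g) ≡ 6 * (2 * 2 + (1 + g))
  9d≤ = solve-∀
  <8de : ∀ g → 34 + (14 + 96 * g) ≡ 8 * 2 * (3 + 6 * g)
  <8de = solve-∀
¬balanced A 3 (suc g) τ b c 0<d A+d≡ b+c≡ eq =
  unbalanced A 3 (1 + g) (6 + 6 * g) τ (b * c) A+d≡ (9+e≡ g) 0<d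
    (≤-trans (m≤m+n 27 (33 + 6 * g)) (≤-reflexive (9d≤ g)))
    (<-≤-trans (m≤m+n 58 (86 + 144 * g)) (≤-reflexive (<8de g))) eq
  where
  9+e≡ : ∀ g → 9 + (6 + 6 * g) ≡ 6 * (1 + g) + 3 * 3
  9+e≡ = solve-∀
  9d≤ : ∀ g → 27 + (33 + 6 * g) ≡ 6 * (3 * 3 + (1 + g))
  9d≤ = solve-∀
  <8de : ∀ g → 58 + (86 + 144 * g) ≡ 8 * 3 * (6 + 6 * g)
  <8de = solve-∀
¬balanced A d@(suc (suc (suc (suc k)))) g τ b c 0<d A+d≡ b+c≡ eq =
  unbalanced A d g (6 * g + 3 * k + 3) τ (b * c) A+d≡ (9+e≡ g k) 0<d
    (≤-trans (m≤m+n (9 * d) _) (≤-reflexive (9d≤ g k)))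
    (<-≤-trans (m<m+n _ (s≤s z≤n)) (≤-reflexive (<8de g k))) eq
  where
  9+e≡ : ∀ g k → 9 + (6 * g + 3 * k + 3) ≡ 6 * g + 3 * (4 + k)
  9+e≡ = solve-∀
  9d≤ : ∀ g k → 9 * (4 + k) + (60 + 39 * k + 6 * (k * k) + 6 * g) ≡ 6 * ((4 + k) * (4 + k) + g)
  9d≤ = solve-∀
  <8de : ∀ g k → 3 * ((4 + k) * (4 + k)) + 9 * (4 + k) + 3 +
    suc (8 + 87 * k + 21 * (k * k) + 48 * (g * (4 + k))) ≡ 8 * (4 + k) * (6 * g + 3 * k + 3)
  <8de = solve-∀

-- From the cubic relation to a lower bound for d².

-- Tripling the relation turns 3H into A + d. Expanded in b and c, both sides share 3A³ + 2(b + c)A²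
-- + bcA, and without it the A² terms compare b + c with 3d.
differences-equation : ∀ A b c d H → A + d ≡ 3 * H → let B = A + b; C = A + c in
  H * (A * B + B * C + C * A) + (A + B + C) ≡ A * B * C →
  A * A * (b + c) + 2 * (b * c) * A ≡
  A * A * (3 * d) + (2 * (d * (b + c)) * A + d * (b * c) + 9 * A + 3 * (b + c))
differences-equation A b c d H A+d≡3H eq = +-cancelˡ-≡
  (3 * (A * A * A) + 2 * (b + c) * (A * A) + b * c * A) _ _
  (trans (sym (expandˡ A b c)) (trans 3σ₃≡ (expandʳ A b c d)))
  where
  B C σ₂ : ℕ
  B = A + b
  C = A + c
  σ₂ = A * B + B * C + C * A

  3σ₃≡ : 3 * (A * B * C) ≡ (A + d) * σ₂ + 3 * (A + B + C)
  3σ₃≡ = begin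
    3 * (A * B * C)                  ≡⟨ cong (3 *_) eq ⟨
    3 * (H * σ₂ + (A + B + C))       ≡⟨ *-distribˡ-+ 3 (H * σ₂) _ ⟩
    3 * (H * σ₂) + 3 * (A + B + C)   ≡⟨ cong (_+ 3 * (A + B + C)) (*-assoc 3 H σ₂) ⟨
    3 * H * σ₂ + 3 * (A + B + C)     ≡⟨ cong (λ z → z * σ₂ + 3 * (A + B + C)) A+d≡3H ⟨
    (A + d) * σ₂ + 3 * (A + B + C)   ∎
    where open ≡-Reasoning

  expandˡ : ∀ A b c → 3 * (A * (A + b) * (A + c)) ≡
    (3 * (A * A * A) + 2 * (b + c) * (A * A) + b * c * A) + (A * A * (b + c) + 2 * (b * c) * A)
  expandˡ = solve-∀
  expandʳ : ∀ A b c d →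
    (A + d) * (A * (A + b) + (A + b) * (A + c) + (A + c) * A) + 3 * (A + (A + b) + (A + c)) ≡
    (3 * (A * A * A) + 2 * (b + c) * (A * A) + b * c * A) +
    (A * A * (3 * d) + (2 * (d * (b + c)) * A + d * (b * c) + 9 * A + 3 * (b + c)))
  expandʳ = solve-∀

-- If u = b + c ≤ 3d, then 4bc ≤ u² ≤ 3du, so bc ≤ du. Each term on the left is then matched by one
-- on the right, where 9A is left over.
3d<b+c : ∀ A b c d → 0 < A →
  A * A * (b + c) + 2 * (b * c) * A ≡
  A * A * (3 * d) + (2 * (d * (b + c)) * A + d * (b * c) + 9 * A + 3 * (b + c)) →
  3 * d < b + c
3d<b+c A b c d 0<A eq = ≰⇒> λ u≤3d → <⇒≢ (lhs< u≤3d) eq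
  where
  open ≤-Reasoning
  u v : ℕ
  u = b + c
  v = b * c

  v≤du : u ≤ 3 * d → v ≤ d * u
  v≤du u≤3d = *-cancelˡ-≤ 4 (begin
    4 * v                              ≡⟨ id₁ b c ⟩
    2 * v + 2 * v                      ≤⟨ +-monoˡ-≤ (2 * v) (2*m*n≤m*m+n*n b c) ⟩
    b * b + c * c + 2 * v              ≡⟨ id₂ b c ⟩
    u * u                              ≤⟨ *-monoˡ-≤ u u≤3d ⟩
    3 * d * u                          ≤⟨ m≤n+m _ (d * u) ⟩
    d * u + 3 * d * u                  ≡⟨ cong (λ z → d * u + z) (*-assoc 3 d u) ⟩
    4 * (d * u)                        ∎)
    where
    id₁ : ∀ b c → 4 * (b * c) ≡ 2 * (b * c) + 2 * (b * c)
    id₁ = solve-∀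
    id₂ : ∀ b c → b * b + c * c + 2 * (b * c) ≡ (b + c) * (b + c)
    id₂ = solve-∀

  lhs< : u ≤ 3 * d → A * A * u + 2 * v * A < A * A * (3 * d) + (2 * (d * u) * A + d * v + 9 * A + 3 * u)
  lhs< u≤3d = +-mono-≤-< (*-monoʳ-≤ (A * A) u≤3d) (begin-strict
    2 * v * A                                ≤⟨ *-monoˡ-≤ A (*-monoʳ-≤ 2 (v≤du u≤3d)) ⟩
    2 * (d * u) * A                          <⟨ m<m+n _ (*-mono-< {0} {9} (s≤s z≤n) 0<A) ⟩
    2 * (d * u) * A + 9 * A                  ≤⟨ +-monoˡ-≤ (9 * A) (m≤m+n (2 * (d * u) * A) (d * v)) ⟩
    2 * (d * u) * A + d * v + 9 * A          ≤⟨ m≤m+n _ _ ⟩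
    2 * (d * u) * A + d * v + 9 * A + 3 * u  ∎)

-- For H = 2h this is the condition 2d² > H. Otherwise h = d² + g, and b + c = 3d + 1 + τ turns the
-- equation into an instance of `Balanced`.
h<d² : ∀ A b c d h → 0 < A → 0 < b → 0 < c → 0 < d → A + d ≡ 6 * h →
  A * A * (b + c) + 2 * (b * c) * A ≡
  A * A * (3 * d) + (2 * (d * (b + c)) * A + d * (b * c) + 9 * A + 3 * (b + c)) →
  h < d * d
h<d² A b@(suc b′) c@(suc c′) d h 0<A _ _ 0<d A+d≡6h eq =
  ≰⇒> λ d²≤h → contra (m≤n⇒∃[o]m+o≡n d²≤h)
  where
  cancelled : ∀ {u v u′ v′ τ} → u ≡ u′ → v ≡ v′ → 3 * d + 1 + τ ≡ u′ →
    A * A * u + 2 * v * A ≡ A * A * (3 * d) + (2 * (d * u) * A + d * v + 9 * A + 3 * u) →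
    A * A * (1 + τ) + 2 * v′ * A ≡
      2 * (d * (3 * d + 1 + τ)) * A + d * v′ + 9 * A + 3 * (3 * d + 1 + τ)
  cancelled {v = v} {τ = τ} refl refl refl e =
    +-cancelˡ-≡ (A * A * (3 * d)) _ _ (trans (sym (id (A * A) d τ (2 * v * A))) e)
    where
    id : ∀ X d τ y → X * (3 * d + 1 + τ) + y ≡ X * (3 * d) + (X * (1 + τ) + y)
    id = solve-∀

  contra : ∃[ g ] d * d + g ≡ h → ⊥
  contra (g , d²+g≡h) with m<n⇒∃[o]m+1+o≡n (3d<b+c A b c d 0<A eq)
  ... | τ , 3d+1+τ≡u = ¬balanced A d g τ b′ c′ 0<d
    (trans A+d≡6h (cong (6 *_) (sym d²+g≡h))) b+c≡
    (cancelled refl v≡ (trans (+-assoc (3 * d) 1 τ) 3d+1+τ≡u) eq)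
    where
    b+c≡ : b + c′ ≡ 3 * d + τ
    b+c≡ = suc-injective (trans (sym (+-suc b c′)) (trans (sym 3d+1+τ≡u) (+-suc (3 * d) τ)))

    -- As bc - (b + c - 1) = (b - 1)(c - 1), the w of `Balanced` is `b′ * c′`.
    product : ∀ b c → suc b * suc c ≡ suc b + c + b * c
    product = solve-∀

    v≡ : b * c ≡ 3 * d + τ + b′ * c′
    v≡ = trans (product b′ c′) (cong (_+ b′ * c′) b+c≡)

-- The multiplier K and the case distinction.

-- The difference 3BC - (AB + BC + CA) = B(C - A) + C(B - A) is at least 2B + C, so with H ≥ 2 it
-- outweighs A + B + C. It remains to divide by BC.
K*A<3*H : ∀ A B C H K → 2 ≤ H → A < B → B < C →
  H * (A * B + B * C + C * A) + (A + B + C) ≡ K * (A * B * C) → K * A < 3 * H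
K*A<3*H A B C H K 2≤H A<B B<C eq
  with m≤n⇒∃[o]m+o≡n 2≤H | m≤n⇒∃[o]m+o≡n A<B | m≤n⇒∃[o]m+o≡n B<C
... | h , refl | b , refl | c , refl = *-cancelʳ-< (B * C) _ _ (begin-strict
  K * A * (B * C)                    ≡⟨ *-assoc K A (B * C) ⟩
  K * (A * (B * C))                  ≡⟨ cong (K *_) (*-assoc A B C) ⟨
  K * (A * B * C)                    ≡⟨ eq ⟨
  H * (A * B + B * C + C * A) + (A + B + C) <⟨ m<m+n _ (s≤s z≤n) ⟩
  _                                  ≡⟨ slack A h b c ⟩
  3 * H * (B * C)                    ∎)
  where
  open ≤-Reasoning
  slack : ∀ A h b c → let B = suc A + b; C = suc B + c in
    (2 + h) * (A * B + B * C + C * A) + (A + B + C) +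
    suc (4 + 3 * A + 4 * (A * b) + 2 * (A * b * h) + 2 * (A * c) + A * c * h + 3 * (A * h) +
         10 * b + 4 * (b * b) +
         2 * (b * b * h) + 4 * (b * c) + 2 * (b * c * h) + 6 * (b * h) + 3 * c + 2 * (c * h) + 4 * h)
    ≡ 3 * (2 + h) * (B * C)
  slack = solve-∀

separated-unit : ∀ A B C H → 0 < A → A < B → B < C → 2 ∣ H →
  H * (A * B + B * C + C * A) + (A + B + C) ≡ A * B * C → A < 3 * H → Separated A (A * H)
separated-unit A B C H 0<A A<B B<C 2∣H eq A<3H with m<n⇒∃[o]m+1+o≡n A<3H
... | d-1 , A+d≡3H with suc d-1 ≤? A
...   | no d≰A = separated-wide A H 0<A (begin-strict
  2 * A        ≡⟨ cong (λ z → A + z) (+-identityʳ A) ⟩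
  A + A        <⟨ +-monoʳ-< A (≰⇒> d≰A) ⟩
  A + suc d-1  ≡⟨ A+d≡3H ⟩
  3 * H        ∎)
  where open ≤-Reasoning
...   | yes d≤A with 2∣H | m<n⇒∃[o]m+1+o≡n A<B | m<n⇒∃[o]m+1+o≡n (<-trans A<B B<C)
...     | divides h refl | b-1 , refl | c-1 , refl =
  -- Since H is even, A + d = 6h is a multiple of 6, so h < d² sharpens to A + d + 6 ≤ 6d².
  separated-narrow A (suc d-1) H (s≤s z≤n) d≤A A+d≡3H (begin
    A + suc d-1 + 6      ≡⟨ cong (_+ 6) A+d≡6h ⟩
    6 * h + 6            ≡⟨ +-comm (6 * h) 6 ⟩
    6 + 6 * h            ≡⟨ *-suc 6 h ⟨
    6 * suc h            ≤⟨ *-monoʳ-≤ 6 (h<d² A (suc b-1) (suc c-1) (suc d-1) h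
                              0<A (s≤s z≤n) (s≤s z≤n) (s≤s z≤n) A+d≡6h
                              (differences-equation A (suc b-1) (suc c-1) (suc d-1) H A+d≡3H eq)) ⟩
    6 * (suc d-1 * suc d-1)  ∎)
  where
  open ≤-Reasoning
  A+d≡6h : A + suc d-1 ≡ 6 * h
  A+d≡6h = trans A+d≡3H (trans (cong (3 *_) (*-comm h 2)) (sym (*-assoc 3 2 h)))

separated : ∀ A B C H K → 0 < A → A < B → B < C → 2 ≤ H → 2 ∣ H →
  H * (A * B + B * C + C * A) + (A + B + C) ≡ K * (A * B * C) → Separated A (A * H)
separated A B C H K 0<A A<B B<C 2≤H 2∣H eq with K | eq | K*A<3*H A B C H K 2≤H A<B B<C eq
... | 0           | σ≡0  | _     = ⊥-elim (<⇒≢ 0<A (sym (m+n≡0⇒m≡0 A (m+n≡0⇒m≡0 (A + B)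
                                     (m+n≡0⇒n≡0 (H * (A * B + B * C + C * A)) σ≡0)))))
... | 1           | σ≡σ₃ | A<3H  = separated-unit A B C H 0<A A<B B<C 2∣H
                                     (trans σ≡σ₃ (*-identityˡ _)) (subst (_< 3 * H) (*-identityˡ A) A<3H)
... | suc (suc L) | _    | KA<3H = separated-wide A H 0<A (≤-<-trans (*-monoˡ-≤ A (m≤m+n 2 L)) KA<3H)

-- Divisibility: the cubic relation from the Korselt conditions.

coprime-divisors⇒*∣ : ∀ {m n o} → Coprime m n → m ∣ o → n ∣ o → m * n ∣ o
coprime-divisors⇒*∣ {m} {n} c (divides x refl) n∣o =
  subst (m * n ∣_) (*-comm m x) (*-monoʳ-∣ m
    (coprime-divisor (λ (i∣n , i∣m) → c (i∣m , i∣n)) (subst (n ∣_) (*-comm x m) n∣o)))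

-- A common divisor of mn and o is coprime to m, hence divides n.
coprime-*ˡ : ∀ {m n o} → Coprime m o → Coprime n o → Coprime (m * n) o
coprime-*ˡ m⊥o n⊥o (i∣mn , i∣o) =
  n⊥o (coprime-divisor (λ (j∣i , j∣m) → m⊥o (j∣m , ∣-trans j∣i i∣o)) i∣mn , i∣o)

-- (1 + AH)(1 + BH)(1 + CH) = 1 + H · cofactor.

cofactor : (A B C H : ℕ) → ℕ
cofactor A B C H = H * H * (A * B * C) + (H * (A * B + B * C + C * A) + (A + B + C))

-- Every term of the cofactor other than C itself contains A or B.
∣cofactor : ∀ A B C H i → i ∣ cofactor A B C H → i ∣ A → i ∣ B → i ∣ C
∣cofactor A B C H i i∣X i∣A i∣B = ∣m+n∣m⇒∣n (subst (i ∣_) (sym (split A B C H)) i∣X)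
  (∣m∣n⇒∣m+n (∣m⇒∣m*n _ i∣A) (∣m⇒∣m*n _ i∣B))
  where
  split : ∀ A B C H → A * (H * H * (B * C) + H * (B + C) + 1) + B * (H * C + 1) + C ≡
                      H * H * (A * B * C) + (H * (A * B + B * C + C * A) + (A + B + C))
  split = solve-∀

-- Cyclic symmetry lets `∣cofactor` serve all three pairs.
cofactor-cycle : ∀ A B C H → cofactor A B C H ≡ cofactor B C A H
cofactor-cycle = expanded
  where
  expanded : ∀ A B C H → H * H * (A * B * C) + (H * (A * B + B * C + C * A) + (A + B + C)) ≡
                         H * H * (B * C * A) + (H * (B * C + C * A + A * B) + (B + C + A))
  expanded = solve-∀

product∣ : ∀ A B C H → (∀ {i} → i ∣ A → i ∣ B → i ∣ C → i ≡ 1) →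
  A ∣ cofactor A B C H → B ∣ cofactor A B C H → C ∣ cofactor A B C H →
  A * B * C ∣ H * (A * B + B * C + C * A) + (A + B + C)
product∣ A B C H 1-common A∣X B∣X C∣X = ∣m+n∣m⇒∣n
  (coprime-divisors⇒*∣ (coprime-*ˡ AC BC) (coprime-divisors⇒*∣ AB A∣X B∣X) C∣X) (n∣m*n (H * H))
  where
  X₁ : cofactor A B C H ≡ cofactor B C A H
  X₁ = cofactor-cycle A B C H
  X₂ : cofactor A B C H ≡ cofactor C A B H
  X₂ = trans X₁ (cofactor-cycle B C A H)
  AB : Coprime A B
  AB {i} (i∣A , i∣B) = 1-common i∣A i∣B (∣cofactor A B C H i (∣-trans i∣A A∣X) i∣A i∣B)
  BC : Coprime B C
  BC {i} (i∣B , i∣C) =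
    1-common (∣cofactor B C A H i (subst (i ∣_) X₁ (∣-trans i∣B B∣X)) i∣B i∣C) i∣B i∣C
  AC : Coprime A C
  AC {i} (i∣A , i∣C) =
    1-common i∣A (∣cofactor C A B H i (subst (i ∣_) X₂ (∣-trans i∣A A∣X)) i∣C i∣A) i∣C

odd⇒2∣∸1 : ∀ n → 2 ∤ n → 2 ∣ n ∸ 1
odd⇒2∣∸1 0 2∤n = 2 ∣0
odd⇒2∣∸1 1 2∤n = 2 ∣0
odd⇒2∣∸1 (suc (suc n)) 2∤n = 2∣1+n n 2∤n
  where
  2∣1+n : ∀ n → 2 ∤ suc (suc n) → 2 ∣ suc n
  2∣1+n 0 2∤ = ⊥-elim (2∤ ∣-refl)
  2∣1+n 1 2∤ = ∣-refl
  2∣1+n (suc (suc n)) 2∤ =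
    ∣m∣n⇒∣m+n (∣-refl {2}) (2∣1+n n λ 2∣ → 2∤ (∣m∣n⇒∣m+n (∣-refl {2}) 2∣))

H*cofactor : ∀ A B C H → suc (A * H) * suc (B * H) * suc (C * H) ≡ suc (cofactor A B C H * H)
H*cofactor = expanded
  where
  expanded : ∀ A B C H → suc (A * H) * suc (B * H) * suc (C * H) ≡
             suc ((H * H * (A * B * C) + (H * (A * B + B * C + C * A) + (A + B + C))) * H)
  expanded = solve-∀

m*n≡o∸1⇒o≡1+m*n : ∀ {m n o} → 1 ≤ o → o ∸ 1 ≡ m * n → o ≡ suc (m * n)
m*n≡o∸1⇒o≡1+m*n 1≤o eq = trans (sym (m+[n∸m]≡n 1≤o)) (cong suc eq)

n∸1≡cofactor*H : ∀ {n p q r A B C H} → 1 < p → 1 < q → 1 < r → n ≡ p * q * r →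
  p ∸ 1 ≡ A * H → q ∸ 1 ≡ B * H → r ∸ 1 ≡ C * H → n ∸ 1 ≡ cofactor A B C H * H
n∸1≡cofactor*H {n} {p} {q} {r} {A} {B} {C} {H} 1<p 1<q 1<r n≡ p≡ q≡ r≡ = begin
  n ∸ 1
    ≡⟨ cong (_∸ 1) n≡ ⟩
  p * q * r ∸ 1
    ≡⟨ cong₂ (λ x y → x * y ∸ 1) (cong₂ _*_ (lift 1<p p≡) (lift 1<q q≡)) (lift 1<r r≡) ⟩
  suc (A * H) * suc (B * H) * suc (C * H) ∸ 1
    ≡⟨ cong (_∸ 1) (H*cofactor A B C H) ⟩
  cofactor A B C H * H                             ∎
  where
  open ≡-Reasoning
  lift : ∀ {m n} → 1 < m → m ∸ 1 ≡ n → m ≡ suc n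
  lift 1<m eq = trans (sym (m+[n∸m]≡n (<⇒≤ 1<m))) (cong suc eq)

-- The product iH divides a, b and c, hence their gcd H.
gcd-quotients-coprime : ∀ {a b c A B C H i} .{{_ : NonZero H}} → gcd a (gcd b c) ≡ H →
  a ≡ A * H → b ≡ B * H → c ≡ C * H → i ∣ A → i ∣ B → i ∣ C → i ≡ 1
gcd-quotients-coprime {H = H} {i} gcd≡H refl refl refl i∣A i∣B i∣C = ∣1⇒≡1 (*-cancelʳ-∣ H
  (subst (i * H ∣_) (trans gcd≡H (sym (*-identityˡ H)))
    (gcd-greatest (*-monoˡ-∣ H i∣A) (gcd-greatest (*-monoˡ-∣ H i∣B) (*-monoˡ-∣ H i∣C)))))

K₃N-separated : ∀ {n} (k : K₃N n) → let open K₃N k in Separated A (p ∸ 1)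
K₃N-separated {n} k = main A H refl (sym A*H≡p-1)
  (∣-trans (gcd[m,n]∣n (p ∸ 1) _) (gcd[m,n]∣m (q ∸ 1) (r ∸ 1)))
  (∣-trans (gcd[m,n]∣n (p ∸ 1) _) (gcd[m,n]∣n (q ∸ 1) (r ∸ 1)))
  where
  open K₃N k

  main : ∀ A H .{{_ : NonZero H}} → gcd (p ∸ 1) (gcd (q ∸ 1) (r ∸ 1)) ≡ H → p ∸ 1 ≡ A * H →
         H ∣ q ∸ 1 → H ∣ r ∸ 1 → Separated A (p ∸ 1)
  main A H gcd≡H p-1≡AH (divides B q-1≡BH) (divides C r-1≡CH) =
    subst (Separated A) (sym p-1≡AH) (separated A B C H (quotient σ₃∣σ)
      0<A A<B B<C (∣⇒≤ 2∣H) 2∣H (_∣_.equality σ₃∣σ))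
    where
    1<q : 1 < q
    1<q = <-trans 1<p p<q
    ∣X : ∀ D {x} → x ≡ D * H → x ∣ n ∸ 1 → D ∣ cofactor A B C H
    ∣X D x≡DH x∣n-1 = *-cancelʳ-∣ H (subst₂ _∣_ x≡DH
      (n∸1≡cofactor*H {n} {p} {q} {r} {A} {B} {C} 1<p 1<q 1<r n≡pqr p-1≡AH q-1≡BH r-1≡CH) x∣n-1)
    σ₃∣σ : A * B * C ∣ H * (A * B + B * C + C * A) + (A + B + C)
    σ₃∣σ = product∣ A B C H (gcd-quotients-coprime gcd≡H p-1≡AH q-1≡BH r-1≡CH)
      (∣X A p-1≡AH p-1∣n-1) (∣X B q-1≡BH q-1∣n-1) (∣X C r-1≡CH r-1∣n-1)
    2∣H : 2 ∣ H
    2∣H = subst (2 ∣_) gcd≡H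
      (gcd-greatest (odd⇒2∣∸1 p p-odd) (gcd-greatest (odd⇒2∣∸1 q q-odd) (odd⇒2∣∸1 r r-odd)))
    0<A : 0 < A
    0<A = *-cancelʳ-< H 0 A (subst (0 <_) p-1≡AH (m<n⇒0<n∸m 1<p))
    A<B : A < B
    A<B = *-cancelʳ-< H A B (subst₂ _<_ p-1≡AH q-1≡BH (∸-monoˡ-< p<q (<⇒≤ 1<p)))
    B<C : B < C
    B<C = *-cancelʳ-< H B C (subst₂ _<_ q-1≡BH r-1≡CH (∸-monoˡ-< q<r (<⇒≤ 1<q)))

-- Passage from the integers to the cuts.

ι-homo-+ : ∀ m n → ι (m + n) ≡ ι m ℚ.+ ι n
ι-homo-+ zero n = sym (ℚ.+-identityˡ (ι n))
ι-homo-+ (suc m) n = begin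
  ι (suc (m + n))        ≡⟨ ι-suc (m + n) ⟩
  1ℚ ℚ.+ ι (m + n)       ≡⟨ cong (1ℚ ℚ.+_) (ι-homo-+ m n) ⟩
  1ℚ ℚ.+ (ι m ℚ.+ ι n)     ≡⟨ ℚ.+-assoc 1ℚ (ι m) (ι n) ⟨
  1ℚ ℚ.+ ι m ℚ.+ ι n       ≡⟨ cong (ℚ._+ ι n) (ι-suc m) ⟨
  ι (suc m) ℚ.+ ι n        ∎
  where open ≡-Reasoning

ι-homo-* : ∀ m n → ι (m * n) ≡ ι m ℚ.* ι n
ι-homo-* zero n = sym (ℚ.*-zeroˡ (ι n))
ι-homo-* (suc m) n = begin
  ι (n + m * n)               ≡⟨ ι-homo-+ n (m * n) ⟩
  ι n ℚ.+ ι (m * n)             ≡⟨ cong₂ ℚ._+_ (sym (ℚ.*-identityˡ (ι n))) (ι-homo-* m n) ⟩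
  1ℚ ℚ.* ι n ℚ.+ ι m ℚ.* ι n    ≡⟨ ℚ.*-distribʳ-+ (ι n) 1ℚ (ι m) ⟨
  (1ℚ ℚ.+ ι m) ℚ.* ι n          ≡⟨ cong (ℚ._* ι n) (ι-suc m) ⟨
  ι (suc m) ℚ.* ι n             ∎
  where open ≡-Reasoning

ι-mono-< : ∀ {m n} → m < n → ι m ℚ.< ι n
ι-mono-< {m} {n} m<n =
  *<* (subst₂ ℤ._<_ (sym (ℤ.*-identityʳ (+ m))) (sym (ℤ.*-identityʳ (+ n))) (ℤ.+<+ m<n))

n/1≡ιn : ∀ n → + n / 1 ≡ ι n
n/1≡ιn n = ℚ.fromℚᵘ-toℚᵘ (ι n)

ι[d]*[n/d]≡ι[n] : ∀ n d .{{_ : NonZero d}} → ι d ℚ.* (+ n / d) ≡ ι n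
ι[d]*[n/d]≡ι[n] n d@(suc d-1) = ℚ.toℚᵘ-injective (begin
  toℚᵘ (ι d ℚ.* (+ n / d))              ≈⟨ ℚ.toℚᵘ-homo-* (ι d) (+ n / d) ⟩
  toℚᵘ (ι d) ℚᵘ.* toℚᵘ (+ n / d)        ≈⟨ ℚᵘ.*-congˡ {toℚᵘ (ι d)}
                                             (ℚ.toℚᵘ-fromℚᵘ (ℚᵘ.mkℚᵘ (+ n) d-1)) ⟩
  toℚᵘ (ι d) ℚᵘ.* ℚᵘ.mkℚᵘ (+ n) d-1     ≈⟨ ℚᵘ.*≡* (trans (ℤ.*-identityʳ _)
                                             (trans (ℤ.*-comm (+ d) (+ n))
                                             (cong (λ z → + n ℤ.* + z) (sym (*-identityˡ d))))) ⟩
  toℚᵘ (ι n)                            ∎)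
  where open ℚᵘ.≃-Reasoning

-- Fractions x = k/c and y = l/c over a common denominator are compared by their numerators.
scaled-< : ∀ c {x y} k l → ι c ℚ.* x ≡ ι k → ι c ℚ.* y ≡ ι l → k < l → x ℚ.< y
scaled-< c k l cx≡k cy≡l k<l =
  ℚ.*-cancelˡ-<-nonNeg (ι c) (subst₂ ℚ._<_ (sym cx≡k) (sym cy≡l) (ι-mono-< k<l))

-- For w = M/N, the factor 12N⁴ clears the denominators of both w⁴ and P/12.
scaled-w⁴ : ∀ {M N w} → ι N ℚ.* w ≡ ι M →
  ι (12 * (N * N * (N * N))) ℚ.* w ^ 4 ≡ ι (12 * (M * M * (M * M)))
scaled-w⁴ {M} {N} {w} Nw≡M = begin
  ι (12 * (N * N * (N * N))) ℚ.* w ^ 4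
    ≡⟨ cong (ℚ._* w ^ 4) (ι-homo-12* N) ⟩
  ι 12 ℚ.* (ι N ℚ.* ι N ℚ.* (ι N ℚ.* ι N)) ℚ.* w ^ 4
    ≡⟨ solve 2 (λ n w → con (ι 12) :* (n :* n :* (n :* n)) :* (w :* (w :* (w :* (w :* con 1ℚ)))) :=
                 con (ι 12) :* ((n :* w) :* (n :* w) :* ((n :* w) :* (n :* w)))) refl (ι N) w ⟩
  ι 12 ℚ.* (ι N ℚ.* w ℚ.* (ι N ℚ.* w) ℚ.* (ι N ℚ.* w ℚ.* (ι N ℚ.* w)))
    ≡⟨ cong (λ z → ι 12 ℚ.* (z ℚ.* z ℚ.* (z ℚ.* z))) Nw≡M ⟩
  ι 12 ℚ.* (ι M ℚ.* ι M ℚ.* (ι M ℚ.* ι M))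
    ≡⟨ ι-homo-12* M ⟨
  ι (12 * (M * M * (M * M))) ∎
  where
  open ≡-Reasoning
  ι-homo-12* : ∀ n → ι (12 * (n * n * (n * n))) ≡ ι 12 ℚ.* (ι n ℚ.* ι n ℚ.* (ι n ℚ.* ι n))
  ι-homo-12* n = trans (ι-homo-* 12 (n * n * (n * n)))
    (cong (ι 12 ℚ.*_) (trans (ι-homo-* (n * n) (n * n)) (cong (λ z → z ℚ.* z) (ι-homo-* n n))))

scaled-P/12 : ∀ P N → ι (12 * (N * N * (N * N))) ℚ.* (+ P / 12) ≡ ι (P * (N * N * (N * N)))
scaled-P/12 P N = begin
  ι (12 * N⁴) ℚ.* (+ P / 12)
    ≡⟨ cong (ℚ._* (+ P / 12)) (trans (cong ι (*-comm 12 N⁴)) (ι-homo-* N⁴ 12)) ⟩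
  ι N⁴ ℚ.* ι 12 ℚ.* (+ P / 12)       ≡⟨ ℚ.*-assoc (ι N⁴) (ι 12) (+ P / 12) ⟩
  ι N⁴ ℚ.* (ι 12 ℚ.* (+ P / 12))     ≡⟨ cong (ι N⁴ ℚ.*_) (ι[d]*[n/d]≡ι[n] P 12) ⟩
  ι N⁴ ℚ.* ι P                       ≡⟨ ι-homo-* N⁴ P ⟨
  ι (N⁴ * P)                         ≡⟨ cong ι (*-comm N⁴ P) ⟩
  ι (P * N⁴)                         ∎
  where
  open ≡-Reasoning
  N⁴ = N * N * (N * N)

scaled-x² : ∀ {A M N w} → ι N ℚ.* w ≡ ι M →
  ι (2 * N * (2 * N)) ℚ.* (ι A ℚ.+ ½ ℚ.* w) ^ 2 ≡ ι ((2 * (A * N) + M) * (2 * (A * N) + M))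
scaled-x² {A} {M} {N} {w} Nw≡M = begin
  ι (2 * N * (2 * N)) ℚ.* x ^ 2
    ≡⟨ cong (ℚ._* x ^ 2) (trans (ι-homo-* (2 * N) (2 * N)) (cong (λ z → z ℚ.* z) (ι-homo-* 2 N))) ⟩
  ι 2 ℚ.* ι N ℚ.* (ι 2 ℚ.* ι N) ℚ.* x ^ 2
    ≡⟨ solve 3 (λ a n w → con (ι 2) :* n :* (con (ι 2) :* n) :*
                   ((a :+ con ½ :* w) :* ((a :+ con ½ :* w) :* con 1ℚ)) :=
                 (con (ι 2) :* (a :* n) :+ n :* w) :* (con (ι 2) :* (a :* n) :+ n :* w)) refl (ι A) (ι N) w ⟩
  (ι 2 ℚ.* (ι A ℚ.* ι N) ℚ.+ ι N ℚ.* w) ℚ.* (ι 2 ℚ.* (ι A ℚ.* ι N) ℚ.+ ι N ℚ.* w)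
    ≡⟨ cong (λ z → z ℚ.* z) (cong₂ ℚ._+_ (cong (ι 2 ℚ.*_) (sym (ι-homo-* A N))) Nw≡M) ⟩
  (ι 2 ℚ.* ι (A * N) ℚ.+ ι M) ℚ.* (ι 2 ℚ.* ι (A * N) ℚ.+ ι M)
    ≡⟨ cong (λ z → (z ℚ.+ ι M) ℚ.* (z ℚ.+ ι M)) (ι-homo-* 2 (A * N)) ⟨
  (ι (2 * (A * N)) ℚ.+ ι M) ℚ.* (ι (2 * (A * N)) ℚ.+ ι M)
    ≡⟨ cong (λ z → z ℚ.* z) (ι-homo-+ (2 * (A * N)) M) ⟨
  ι T ℚ.* ι T
    ≡⟨ ι-homo-* T T ⟨
  ι (T * T) ∎
  where
  open ≡-Reasoning
  x = ι A ℚ.+ ½ ℚ.* w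
  T = 2 * (A * N) + M

scaled-3P : ∀ P N → ι (2 * N * (2 * N)) ℚ.* (+ (3 * P) / 1) ≡ ι (12 * P * (N * N))
scaled-3P P N = begin
  ι (2 * N * (2 * N)) ℚ.* (+ (3 * P) / 1)   ≡⟨ cong (ι (2 * N * (2 * N)) ℚ.*_) (n/1≡ιn (3 * P)) ⟩
  ι (2 * N * (2 * N)) ℚ.* ι (3 * P)         ≡⟨ ι-homo-* (2 * N * (2 * N)) (3 * P) ⟨
  ι (2 * N * (2 * N) * (3 * P))             ≡⟨ cong ι (reorder N P) ⟩
  ι (12 * P * (N * N))                      ∎
  where
  open ≡-Reasoning
  reorder : ∀ N P → 2 * N * (2 * N) * (3 * P) ≡ 12 * P * (N * N)
  reorder = solve-∀

-- With w = M/N the two inequalities read P/12 < w⁴ and (A + w/2)² < 3P, so w bounds the fourth root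
-- from above and A + w/2 bounds the square root from below.
separated⇒<ℝ : ∀ A P → Separated A P →
  fromℕ A <ℝ root 2 (fromℕ (3 * P)) -ℝ ½ · root 4 (fromℚ (+ P / 12))
separated⇒<ℝ A P (M , N , 0<M , 0<N , PN⁴<12M⁴ , T²<12PN²) =
  let i , _ , Ni≡1 = recip (ι-mono-< 0<N)
      w = ι M ℚ.* i
      Nw≡M = q*[s*i]≡s (ι N) (ι M) i Ni≡1
      0<w = scaled-< N 0 M (ℚ.*-zeroʳ (ι N)) Nw≡M 0<M
      x = ι A ℚ.+ ½ ℚ.* w
      0<½w = subst (ℚ._< ½ ℚ.* w) (ℚ.*-zeroʳ ½) (ℚ.*-monoʳ-<-pos ½ 0<w)
      A<x = subst (ℚ._< x) (ℚ.+-identityʳ (ι A)) (ℚ.+-monoʳ-< (ι A) 0<½w)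
      0≤A = subst (0ℚ ℚ.≤_) (n/1≡ιn A) (ℚ.nonNegative⁻¹ (+ A / 1) {{ℚ.normalize-nonNeg A 1}})
      x²<3P = scaled-< (2 * N * (2 * N)) _ _ (scaled-x² {A} {w = w} Nw≡M) (scaled-3P P N) T²<12PN²
      P/12<w⁴ = scaled-< (12 * (N * N * (N * N))) _ _ (scaled-P/12 P N) (scaled-w⁴ {M} {N} {w} Nw≡M) PN⁴<12M⁴
      -- The strict inequality leaves room for some a above A + w/2 with a² < 3P, and then for s
      -- between A and a - w/2.
      a , x<a , a²<3P = ^-cont-above 2 (ℚ.<⇒≤ (ℚ.≤-<-trans 0≤A A<x)) x²<3P
      A<a-½w = subst (ℚ._< a ℚ.- ½ ℚ.* w) (x-½w≡A w) (ℚ.+-monoˡ-< (ℚ.- (½ ℚ.* w)) x<a)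
      s , A<s , s<a-½w = ℚ.<-dense A<a-½w
  in s , subst (ℚ._< s) (sym (n/1≡ιn A)) A<s ,
     a , ½ ℚ.* w , inj₂ (ℚ.<⇒≤ (ℚ.≤-<-trans 0≤A (ℚ.<-trans A<x x<a)) , a²<3P) ,
     -- The upper cut of `½ · y` at w/2 is that of y at (1/½)(w/2), which is w.
     subst (λ z → 0ℚ ℚ.< z × (+ P / 12) ℚ.< z ^ 4) (sym (double-half w)) (0<w , P/12<w⁴) ,
     s<a-½w
  where
  x-½w≡A : ∀ w → ι A ℚ.+ ½ ℚ.* w ℚ.- ½ ℚ.* w ≡ ι A
  x-½w≡A w = solve 2 (λ a h → a :+ h :- h := a) refl (ι A) (½ ℚ.* w)

  double-half : ∀ w → ℚ.1/ ½ ℚ.* (½ ℚ.* w) ≡ w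
  double-half w = trans (sym (ℚ.*-assoc (ℚ.1/ ½) ½ w)) (ℚ.*-identityˡ w)

theorem4p2 : ∀ {n : ℕ} (k : K₃N n) → let open K₃N k in
    fromℕ A <ℝ root 2 (fromℕ (3 * (p ∸ 1))) -ℝ ½ · root 4 (fromℚ (+ (p ∸ 1) / 12))
theorem4p2 k = separated⇒<ℝ A (p ∸ 1) (K₃N-separated k)
  where open K₃N k
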